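{- Let $v\in\{0,1,2\}^n$ with $v\ne0$ and $v\ne(2,\dots,2)$, and let $D=\mathbb{F}_3^n\setminus\mathrm{box}(v)$, so $|D|=3^n-2^{t_1}3^{t_2}>0$. For every nonzero $u\in\mathbb{F}_3^n$, \[ \mathrm{wt}(c_D(u))=\tfrac13\Big(2|D|+3^{t_2}e(u)\,2^{z(u)}(-1)^{o(u)}\phi(s_1(u))\Big), \] and for $e\in\{0,1\}$, $0\le z\le t_1$, $c\in\mathbb{F}_3$, the number of nonzero $u\in\mathbb{F}_3^n$ with $e(u)=e$, $z(u)=z$, $s_1(u)=c$ is \[ \big([e=1]+(3^{t_2}-1)[e=0]\big)\binom{t_1}{z}N_c(t_1-z)\,3^{n-t_1-t_2}, \] less one for $(e,z,c)=(1,t_1,0)$.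
   Context: $[\,\cdot\,]$ applied to a condition is $1$ if it holds and $0$ otherwise; $\mathrm{wt}$ is Hamming weight; $c_D(u)=(u\cdot x)_{x\in D}$ with $u\cdot x=\sum_iu_ix_i\in\mathbb{F}_3$. $\mathbb{F}_3$ is identified with $\{0,1,2\}$. For $v\in\{0,1,2\}^n$: $T_j(v)=\{i:v_i=j\}$, $t_j=|T_j(v)|$, $\mathrm{box}(v)=\prod_i\{0,\dots,v_i\}\subseteq\mathbb{F}_3^n$. For $u\in\mathbb{F}_3^n$: $z(u)=|\{i\in T_1(v):u_i=0\}|$, $o(u)=t_1-z(u)$, $s_1(u)=\sum_{i\in T_1(v)}u_i\in\mathbb{F}_3$, $e(u)=1$ if $u_i=0$ for all $i\in T_2(v)$ and $e(u)=0$ otherwise. For $c\in\mathbb{F}_3$, $\phi(c)=2[c=0]-[c\ne0]$. For an integer $o\ge0$ and $c\in\mathbb{F}_3$, $N_c(o)$ is the number of vectors in $\{1,2\}^o$ whose coordinate sum is $c$ in $\mathbb{F}_3$, i.e. $N_0(o)=(2^o+2(-1)^o)/3$ and $N_c(o)=(2^o-(-1)^o)/3$ for $c\ne0$. -}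

module Defs where

open import Data.Bool.Base using (if_then_else_)
open import Data.Fin.Base as Fin using (Fin; toℕ)
open import Data.Fin.Patterns using (0F; 1F; 2F)
import Data.Fin.Properties as Fin
open import Data.Fin.Subset using (Subset; ∣_∣; _∩_; _∈_)
open import Data.Fin.Subset.Properties using (_∈?_)
open import Data.Integer.Base as ℤ using (ℤ; 0ℤ; 1ℤ; +_)
open import Data.List.Base as List using (List)
open import Data.List.Membership.Propositional as List using ()
import Data.List.Membership.Propositional.Properties as List
open import Data.List.Relation.Unary.All using ([])
open import Data.List.Relation.Unary.AllPairs using ([]; _∷_)
open import Data.List.Relation.Unary.Any using (here)
open import Data.List.Relation.Unary.Unique.Propositional using (Unique)
import Data.List.Relation.Unary.Unique.Propositional.Properties as Unique
open import Data.Nat.Base as ℕ using (ℕ; zero; suc; _∸_)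
open import Data.Nat.DivMod using (_mod_)
open import Data.Vec.Base as Vec using (Vec; []; _∷_; lookup)
import Data.Vec.Properties as Vec
open import Data.Vec.Relation.Binary.Pointwise.Inductive as Pointwise using (Pointwise)
open import Relation.Binary.Definitions using (DecidableEquality)
open import Relation.Binary.PropositionalEquality.Core using (_≡_; _≢_; refl)
open import Relation.Nullary using (Dec; does; ¬?)
open import Relation.Nullary.Decidable using (_→-dec_)
open import Relation.Unary using (Pred; Decidable)

private
  variable
    n : ℕ

⟦_⟧ : ∀ {p} {P : Set p} → Dec P → ℤ
⟦ P? ⟧ = if does P? then 1ℤ else 0ℤ

F₃ : Set
F₃ = Fin 3

infixl 6 _+₃_
infixl 7 _*₃_ _·_

_+₃_ : F₃ → F₃ → F₃
a +₃ b = (toℕ a ℕ.+ toℕ b) mod 3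

_*₃_ : F₃ → F₃ → F₃
a *₃ b = (toℕ a ℕ.* toℕ b) mod 3

Σ₃ : Vec F₃ n → F₃
Σ₃ = Vec.foldr _ _+₃_ 0F

_·_ : Vec F₃ n → Vec F₃ n → F₃
u · x = Σ₃ (Vec.zipWith _*₃_ u x)

𝟎 𝟐 : Vec F₃ n
𝟎 = Vec.replicate _ 0F
𝟐 = Vec.replicate _ 2F

_≟ᵛ_ : DecidableEquality (Vec F₃ n)
_≟ᵛ_ = Vec.≡-dec Fin._≟_

-- All vectors with entries in xs, each listed once if xs has no repetitions
-- (for xs = allFin 3 this is checked by F₃^-complete and F₃^-unique).
words : ∀ {a} {A : Set a} → List A → (n : ℕ) → List (Vec A n)
words xs zero    = List.[ [] ]
words xs (suc n) = List.cartesianProductWith _∷_ xs (words xs n)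

F₃^_ : (n : ℕ) → List (Vec F₃ n)
F₃^ n = words (List.allFin 3) n

F₃^-complete : (x : Vec F₃ n) → x List.∈ (F₃^ n)
F₃^-complete []      = here refl
F₃^-complete (a ∷ x) =
  List.∈-cartesianProductWith⁺ _∷_ (List.∈-allFin a) (F₃^-complete x)

F₃^-unique : ∀ n → Unique (F₃^ n)
F₃^-unique zero    = [] ∷ []
F₃^-unique (suc n) =
  Unique.cartesianProductWith⁺ _∷_ Vec.∷-injective (Unique.allFin⁺ 3) (F₃^-unique n)

#[_] : ∀ {p} {P : Pred (Vec F₃ n) p} → Decidable P → ℕ
#[_] {n} P? = List.length (List.filter P? (F₃^ n))

wt : Vec F₃ n → ℕ
wt = Vec.count (λ a → ¬? (a Fin.≟ 0F))

-- The codeword c_D(u), with coordinates in the order in which D is listed.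
codeword : (D : List (Vec F₃ n)) → Vec F₃ n → Vec F₃ (List.length D)
codeword D u = Vec.map (u ·_) (Vec.fromList D)

T : F₃ → Vec F₃ n → Subset n
T j v = Vec.map (λ a → does (a Fin.≟ j)) v

t : F₃ → Vec F₃ n → ℕ
t j v = ∣ T j v ∣

_∈box_ : Vec F₃ n → Vec F₃ n → Set
x ∈box v = Pointwise Fin._≤_ x v

_∈box?_ : (x v : Vec F₃ n) → Dec (x ∈box v)
_∈box?_ = Pointwise.decidable Fin._≤?_

boxComplement : Vec F₃ n → List (Vec F₃ n)
boxComplement {n} v = List.filter (λ x → ¬? (x ∈box? v)) (F₃^ n)

-- In z, o, s₁ and e below, the first argument is the v defining the box.
-- T 0F u is the set of i with uᵢ = 0.
z : Vec F₃ n → Vec F₃ n → ℕ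
z v u = ∣ T 1F v ∩ T 0F u ∣

-- Truncated subtraction loses nothing, as z v u ≤ t 1F v.
o : Vec F₃ n → Vec F₃ n → ℕ
o v u = t 1F v ∸ z v u

s₁ : Vec F₃ n → Vec F₃ n → F₃
s₁ v u = Σ₃ (Vec.zipWith (λ vᵢ uᵢ → if does (vᵢ Fin.≟ 1F) then uᵢ else 0F) v u)

e : Vec F₃ n → Vec F₃ n → Fin 2
e v u = if does (Fin.all? (λ i → (i ∈? T 2F v) →-dec (lookup u i Fin.≟ 0F))) then 1F else 0F

φ : F₃ → ℤ
φ c = + 2 ℤ.* ⟦ c Fin.≟ 0F ⟧ ℤ.- ⟦ ¬? (c Fin.≟ 0F) ⟧

N : F₃ → ℕ → ℕ
N c k = List.length (List.filter (λ w → Σ₃ w Fin.≟ c) (words (1F List.∷ 2F List.∷ List.[]) k))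

{-# OPTIONS --safe #-}
module Submission where

-- Weights. The function φ c is ω^c + ω^(-c) for a primitive cube root of
-- unity ω, so 3 [c ≠ 0] = 2 - φ c, and 3 wt(c_D(u)) is 2 |D| minus the sum of
-- φ (u · x) over x in D. Over all of F₃^n that sum vanishes for u ≠ 0, hence
-- over D it is minus the sum over box(v). The sum over the box factors over
-- the coordinates: the factor at i is the sum of ω^(uᵢ y) over y ≤ vᵢ, which is
-- 1 if vᵢ = 0; 2 or -ω^(-uᵢ) if vᵢ = 1, as uᵢ = 0 or not; 3 or 0 if vᵢ = 2, as
-- uᵢ = 0 or not. The product is K ω^(-s₁) with the integer
-- K = 3^t₂ e 2^z (-1)^o. To stay inside ℤ, the factorisation is replaced by an
-- induction on v for the shifted sums of φ (c + u · x), whose value is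
-- K φ (c - s₁), with - s₁ written as s₁ + s₁ (∑box-φ). Its single-coordinate
-- step is a finite identity (∑-φ). The vanishing over F₃^n is the case v = 𝟐,
-- where the box is everything and e = 0 unless u = 0.
--
-- Counting. Dropping the condition u ≠ 0 first, ∑-stats is an induction on v
-- that conditions on u₁: a coordinate with v₁ = 0 is free; one with v₁ = 2
-- affects only e; for v₁ = 1 the claim is the Pascal-type recurrence CN-suc for
-- C(m,k) N_c(m-k). The zero vector has (e, z, s₁) = (1, t₁, 0), which accounts
-- for the correction.

open import Defs
open import Data.Bool.Base using (true; false; _∧_; not; if_then_else_)
open import Data.Bool.Properties using (∧-zeroʳ) renaming (_≟_ to _≟𝔹_)
open import Data.Empty using (⊥-elim)
open import Data.Fin.Base using (Fin; zero; suc; toℕ)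
open import Data.Fin.Patterns using (0F; 1F; 2F)
open import Data.Fin.Properties using (all?; toℕ≤pred[n]; _≤?_) renaming (_≟_ to _≟F_)
open import Data.Fin.Subset using (_∈_)
open import Data.Fin.Subset.Properties using (_∈?_; drop-there; ∣p∩q∣≤∣p∣)
open import Data.Integer.Base using (ℤ; 0ℤ; +_; _+_; _-_; _*_; _^_; 1ℤ; -1ℤ)
open import Data.Integer.Properties using (+-identityʳ; *-identityʳ; +-identityˡ; *-identityˡ; *-zeroʳ; *-comm; *-assoc; pos-+) renaming (_≟_ to _≟ℤ_)
open import Data.Integer.Tactic.RingSolver using (solve-∀)
open import Data.List.Base using (List; []; _∷_; length; map; filter; _++_; cartesianProductWith; allFin)
open import Data.List.Membership.Propositional.Properties using (∈-filter⁺; ∈-length)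
open import Data.Nat.Base as ℕ using (ℕ; zero; suc; _∸_; _≤_; _<_; s≤s)
open import Data.Nat.Combinatorics using (_C_; nCk+nC[k+1]≡[n+1]C[k+1]; k>n⇒nCk≡0)
open import Data.Nat.Properties using (m+n∸m≡n; +-∸-assoc; +-suc; ≰⇒>) renaming (_≟_ to _≟ℕ_; _≤?_ to _≤ℕ?_)
open import Data.Product.Base using (_×_; _,_)
open import Data.Rational.Base using (_/_)
open import Data.Rational.Properties using (fromℚᵘ-cong)
open import Data.Rational.Unnormalised.Base using (mkℚᵘ; *≡*)
open import Data.Vec.Base as Vec using (Vec; []; _∷_; lookup; fromList; there)
open import Data.Vec.Relation.Binary.Pointwise.Inductive using ([]; _∷_)
open import Function.Base using (_∘_)
open import Function.Bundles using (_⇔_; mk⇔)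
open import Relation.Binary.PropositionalEquality using (_≡_; _≢_; refl; sym; trans; cong; cong₂; module ≡-Reasoning)
open import Relation.Nullary using (Dec; does; yes; no)
open import Relation.Nullary.Decidable using (¬?; _×-dec_; _→-dec_; does-⇔; dec-true; from-yes)
open import Relation.Unary using (Decidable)

open ≡-Reasoning

private
  variable
    n : ℕ
    A B : Set

-- Finite sums of integers

-- The sum of f over the entries of a list, with multiplicity.
∑ : List A → (A → ℤ) → ℤ
∑ []       f = 0ℤ
∑ (x ∷ xs) f = f x + ∑ xs f

∑-cong : (xs : List A) {f g : A → ℤ} → (∀ x → f x ≡ g x) → ∑ xs f ≡ ∑ xs g
∑-cong []       f≗g = refl
∑-cong (x ∷ xs) f≗g = cong₂ _+_ (f≗g x) (∑-cong xs f≗g)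

∑-zero : (xs : List A) → ∑ xs (λ _ → 0ℤ) ≡ 0ℤ
∑-zero []       = refl
∑-zero (x ∷ xs) = cong (λ r → 0ℤ + r) (∑-zero xs)

∑-*ˡ : (k : ℤ) (xs : List A) (f : A → ℤ) → ∑ xs (λ x → k * f x) ≡ k * ∑ xs f
∑-*ˡ k []       f = sym (*-zeroʳ k)
∑-*ˡ k (x ∷ xs) f = trans (cong (λ r → k * f x + r) (∑-*ˡ k xs f)) (distrib k (f x) (∑ xs f))
  where
  distrib : ∀ k a b → k * a + k * b ≡ k * (a + b)
  distrib = solve-∀

∑-+ : (xs : List A) (f g : A → ℤ) → ∑ xs (λ x → f x + g x) ≡ ∑ xs f + ∑ xs g
∑-+ []       f g = refl
∑-+ (x ∷ xs) f g = trans (cong (λ r → f x + g x + r) (∑-+ xs f g)) (medial (f x) (g x) (∑ xs f) (∑ xs g))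
  where
  medial : ∀ a b c d → (a + b) + (c + d) ≡ (a + c) + (b + d)
  medial = solve-∀

∑-- : (xs : List A) (f g : A → ℤ) → ∑ xs (λ x → f x - g x) ≡ ∑ xs f - ∑ xs g
∑-- []       f g = refl
∑-- (x ∷ xs) f g = trans (cong (λ r → f x - g x + r) (∑-- xs f g)) (medial (f x) (g x) (∑ xs f) (∑ xs g))
  where
  medial : ∀ a b c d → (a - b) + (c - d) ≡ (a + c) - (b + d)
  medial = solve-∀

∑-++ : (xs ys : List A) (f : A → ℤ) → ∑ (xs ++ ys) f ≡ ∑ xs f + ∑ ys f
∑-++ []       ys f = sym (+-identityˡ _)
∑-++ (x ∷ xs) ys f = trans (cong (λ r → f x + r) (∑-++ xs ys f)) (assoc (f x) (∑ xs f) (∑ ys f))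
  where
  assoc : ∀ a b c → a + (b + c) ≡ a + b + c
  assoc = solve-∀

∑-map : (g : A → B) (xs : List A) (f : B → ℤ) → ∑ (map g xs) f ≡ ∑ xs (f ∘ g)
∑-map g []       f = refl
∑-map g (x ∷ xs) f = cong (λ r → f (g x) + r) (∑-map g xs f)

∑-words : (xs : List A) (n : ℕ) (f : Vec A (suc n) → ℤ) →
  ∑ (words xs (suc n)) f ≡ ∑ xs (λ a → ∑ (words xs n) (λ w → f (a ∷ w)))
∑-words {A = A} xs n f = go xs
  where
  go : (ys : List A) →
    ∑ (cartesianProductWith _∷_ ys (words xs n)) f ≡ ∑ ys (λ a → ∑ (words xs n) (λ w → f (a ∷ w)))
  go []       = refl
  go (y ∷ ys) = trans (∑-++ (map (y ∷_) (words xs n)) _ f)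
                      (cong₂ _+_ (∑-map (y ∷_) (words xs n) f) (go ys))

length≡∑ : (xs : List A) → + length xs ≡ ∑ xs (λ _ → 1ℤ)
length≡∑ []       = refl
length≡∑ (x ∷ xs) = trans (pos-+ 1 (length xs)) (cong (λ r → 1ℤ + r) (length≡∑ xs))

length-filter : {P : A → Set} (P? : Decidable P) (xs : List A) →
  + length (filter P? xs) ≡ ∑ xs (λ x → ⟦ P? x ⟧)
length-filter P? []       = refl
length-filter P? (x ∷ xs) with does (P? x)
... | false = trans (length-filter P? xs) (sym (+-identityˡ _))
... | true  = trans (pos-+ 1 _) (cong (λ r → 1ℤ + r) (length-filter P? xs))

∑-filter-¬ : {P : A → Set} (P? : Decidable P) (xs : List A) (f : A → ℤ) →
  ∑ (filter (λ x → ¬? (P? x)) xs) f ≡ ∑ xs f - ∑ xs (λ x → ⟦ P? x ⟧ * f x)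
∑-filter-¬ P? []       f = refl
∑-filter-¬ P? (x ∷ xs) f with does (P? x)
... | false = trans (cong (λ r → f x + r) (∑-filter-¬ P? xs f)) (keep (f x) (∑ xs f) (∑ xs (λ y → ⟦ P? y ⟧ * f y)))
  where
  keep : ∀ a s r → a + (s - r) ≡ (a + s) - (0ℤ * a + r)
  keep = solve-∀
... | true  = trans (∑-filter-¬ P? xs f) (drop (f x) (∑ xs f) (∑ xs (λ y → ⟦ P? y ⟧ * f y)))
  where
  drop : ∀ a s r → s - r ≡ (a + s) - (1ℤ * a + r)
  drop = solve-∀

-- Indicators

⟦×⟧ : {P Q : Set} (P? : Dec P) (Q? : Dec Q) → ⟦ P? ×-dec Q? ⟧ ≡ ⟦ P? ⟧ * ⟦ Q? ⟧
⟦×⟧ P? Q? with does P?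
... | true  = sym (*-identityˡ _)
... | false = refl

⟦¬×⟧ : {P Q : Set} (P? : Dec P) (Q? : Dec Q) → ⟦ ¬? P? ×-dec Q? ⟧ ≡ ⟦ Q? ⟧ - ⟦ P? ⟧ * ⟦ Q? ⟧
⟦¬×⟧ P? Q? with does P? | does Q?
... | true  | true  = refl
... | true  | false = refl
... | false | true  = refl
... | false | false = refl

⟦⟧-cong : {P Q : Set} → P ⇔ Q → (P? : Dec P) (Q? : Dec Q) → ⟦ P? ⟧ ≡ ⟦ Q? ⟧
⟦⟧-cong P⇔Q P? Q? = cong (if_then 1ℤ else 0ℤ) (does-⇔ P⇔Q P? Q?)

-- Sums over all of F₃^n

∑-1 : ∀ n → ∑ (F₃^ n) (λ _ → 1ℤ) ≡ (+ 3) ^ n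
∑-1 zero    = refl
∑-1 (suc n) = begin
  ∑ (F₃^ suc n) (λ _ → 1ℤ)   ≡⟨ ∑-words (allFin 3) n _ ⟩
  S + (S + (S + 0ℤ))         ≡⟨ triple S ⟩
  + 3 * S                    ≡⟨ cong (+ 3 *_) (∑-1 n) ⟩
  + 3 * (+ 3) ^ n            ∎
  where
  S : ℤ
  S = ∑ (F₃^ n) (λ _ → 1ℤ)
  triple : ∀ s → s + (s + (s + 0ℤ)) ≡ + 3 * s
  triple = solve-∀

∑-𝟎 : ∀ n (f : Vec F₃ n → ℤ) → ∑ (F₃^ n) (λ u → ⟦ u ≟ᵛ 𝟎 ⟧ * f u) ≡ f 𝟎
∑-𝟎 zero    f = unit (f [])
  where
  unit : ∀ a → 1ℤ * a + 0ℤ ≡ a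
  unit = solve-∀
∑-𝟎 (suc n) f = begin
  ∑ (F₃^ suc n) (λ u → ⟦ u ≟ᵛ 𝟎 ⟧ * f u)
    ≡⟨ ∑-words (allFin 3) n _ ⟩
  ∑ (F₃^ n) (λ u → ⟦ u ≟ᵛ 𝟎 ⟧ * f (0F ∷ u)) + (∑ (F₃^ n) (λ _ → 0ℤ) + (∑ (F₃^ n) (λ _ → 0ℤ) + 0ℤ))
    ≡⟨ cong₂ (λ a b → a + (b + (b + 0ℤ))) (∑-𝟎 n (f ∘ (0F ∷_))) (∑-zero (F₃^ n)) ⟩
  f 𝟎 + 0ℤ
    ≡⟨ +-identityʳ (f 𝟎) ⟩
  f 𝟎 ∎

-- Identities over F₃, checked on all arguments

+₃-identityˡ : ∀ a → 0F +₃ a ≡ a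
+₃-identityˡ = from-yes (all? λ a → (0F +₃ a) ≟F a)

+₃-assoc : ∀ a b c → a +₃ (b +₃ c) ≡ (a +₃ b) +₃ c
+₃-assoc = from-yes (all? λ a → all? λ b → all? λ c → (a +₃ (b +₃ c)) ≟F ((a +₃ b) +₃ c))

3⟦≢0⟧ : ∀ a → + 3 * ⟦ ¬? (a ≟F 0F) ⟧ ≡ + 2 - φ a
3⟦≢0⟧ = from-yes (all? λ a → + 3 * ⟦ ¬? (a ≟F 0F) ⟧ ≟ℤ (+ 2 - φ a))

-- The factor of K contributed by a coordinate with vᵢ = a and uᵢ = b: the sum
-- of ω^(b y) over y ≤ a, up to the phase ω^(- σ a b).
κ : F₃ → F₃ → ℤ
κ 0F _       = 1ℤ
κ 1F 0F      = + 2
κ 1F (suc _) = -1ℤ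
κ 2F 0F      = + 3
κ 2F (suc _) = 0ℤ

-- The summand of s₁ contributed by such a coordinate.
σ : F₃ → F₃ → F₃
σ a b = if does (a ≟F 1F) then b else 0F

-- Summing over one coordinate of the box replaces the shift c - s by
-- c - (σ a b + s) and multiplies by κ a b; doubling is negation in F₃.
∑-φ : ∀ a b c s →
  ∑ (allFin 3) (λ y → ⟦ y ≤? a ⟧ * φ ((c +₃ b *₃ y) +₃ (s +₃ s)))
    ≡ κ a b * φ (c +₃ ((σ a b +₃ s) +₃ (σ a b +₃ s)))
∑-φ = from-yes (all? λ a → all? λ b → all? λ c → all? λ s →
  ∑ (allFin 3) (λ y → ⟦ y ≤? a ⟧ * φ ((c +₃ b *₃ y) +₃ (s +₃ s)))
    ≟ℤ κ a b * φ (c +₃ ((σ a b +₃ s) +₃ (σ a b +₃ s))))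

-- The statistics e, z and s₁

-- A coordinate with v₁ = 2 and u₁ ≠ 0 makes e zero; any other leaves it alone.
e-∷ : ∀ a b (v u : Vec F₃ n) →
  e (a ∷ v) (b ∷ u) ≡ (if does (a ≟F 2F) ∧ not (does (b ≟F 0F)) then 0F else e v u)
e-∷ a b v u = trans (cong (if_then 1F else 0F) (does-⇔ split (all? (vanishes? (a ∷ v) (b ∷ u)))
                (vanishes? (a ∷ v) (b ∷ u) zero ×-dec all? (vanishes? v u)))) (table a b)
  where
  vanishes? : ∀ {m} (v u : Vec F₃ m) i → Dec (i ∈ T 2F v → lookup u i ≡ 0F)
  vanishes? v u i = (i ∈? T 2F v) →-dec (lookup u i ≟F 0F)

  split : (∀ i → i ∈ T 2F (a ∷ v) → lookup (b ∷ u) i ≡ 0F) ⇔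
          ((zero ∈ T 2F (a ∷ v) → b ≡ 0F) × (∀ i → i ∈ T 2F v → lookup u i ≡ 0F))
  split = mk⇔ (λ h → h zero , λ i i∈ → h (suc i) (there i∈))
              (λ { (h₀ , h) zero → h₀ ; (h₀ , h) (suc i) → h i ∘ drop-there })

  table : ∀ a b →
    (if does (vanishes? (a ∷ v) (b ∷ u) zero ×-dec all? (vanishes? v u)) then 1F else 0F)
      ≡ (if does (a ≟F 2F) ∧ not (does (b ≟F 0F)) then 0F else e v u)
  table 0F b       = refl
  table 1F b       = refl
  table 2F 0F      = refl
  table 2F (suc b) = refl

e-𝟎 : (v : Vec F₃ n) → e v 𝟎 ≡ 1F
e-𝟎 []      = refl
e-𝟎 (a ∷ v) = trans (e-∷ a 0F v 𝟎) (table a)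
  where
  table : ∀ a → (if does (a ≟F 2F) ∧ false then 0F else e v 𝟎) ≡ 1F
  table 0F = e-𝟎 v
  table 1F = e-𝟎 v
  table 2F = e-𝟎 v

z-𝟎 : (v : Vec F₃ n) → z v 𝟎 ≡ t 1F v
z-𝟎 []       = refl
z-𝟎 (0F ∷ v) = z-𝟎 v
z-𝟎 (1F ∷ v) = cong suc (z-𝟎 v)
z-𝟎 (2F ∷ v) = z-𝟎 v

s₁-𝟎 : (v : Vec F₃ n) → s₁ v 𝟎 ≡ 0F
s₁-𝟎 []       = refl
s₁-𝟎 (0F ∷ v) = cong (0F +₃_) (s₁-𝟎 v)
s₁-𝟎 (1F ∷ v) = cong (0F +₃_) (s₁-𝟎 v)
s₁-𝟎 (2F ∷ v) = cong (0F +₃_) (s₁-𝟎 v)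

e-𝟐 : (u : Vec F₃ n) → u ≢ 𝟎 → e 𝟐 u ≡ 0F
e-𝟐 []            u≢𝟎 = ⊥-elim (u≢𝟎 refl)
e-𝟐 (0F ∷ u)      u≢𝟎 = trans (e-∷ 2F 0F 𝟐 u) (e-𝟐 u (u≢𝟎 ∘ cong (0F ∷_)))
e-𝟐 (suc b ∷ u)   u≢𝟎 = e-∷ 2F (suc b) 𝟐 u

z≤t₁ : (v u : Vec F₃ n) → z v u ≤ t 1F v
z≤t₁ v u = ∣p∩q∣≤∣p∣ (T 1F v) (T 0F u)

-- Sums over a box

-- The sum of f over box(v), with box(v) cut out of F₃^n by its indicator.
∑box : Vec F₃ n → (Vec F₃ n → ℤ) → ℤ
∑box {n} v f = ∑ (F₃^ n) (λ x → ⟦ x ∈box? v ⟧ * f x)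

∑box-∷ : ∀ a (v : Vec F₃ n) f →
  ∑box (a ∷ v) f ≡ ∑ (allFin 3) (λ y → ⟦ y ≤? a ⟧ * ∑box v (f ∘ (y ∷_)))
∑box-∷ {n} a v f = trans (∑-words (allFin 3) n _) (∑-cong (allFin 3) fibre)
  where
  fibre : ∀ y → ∑ (F₃^ n) (λ x → ⟦ (y ∷ x) ∈box? (a ∷ v) ⟧ * f (y ∷ x)) ≡ ⟦ y ≤? a ⟧ * ∑box v (f ∘ (y ∷_))
  fibre y = trans
    (∑-cong (F₃^ n) λ x → trans (cong (_* f (y ∷ x)) (⟦×⟧ (y ≤? a) (x ∈box? v)))
                                (*-assoc ⟦ y ≤? a ⟧ ⟦ x ∈box? v ⟧ (f (y ∷ x))))
    (∑-*ˡ ⟦ y ≤? a ⟧ (F₃^ n) _)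

∑box-1 : (v : Vec F₃ n) → ∑box v (λ _ → 1ℤ) ≡ (+ 2) ^ t 1F v * (+ 3) ^ t 2F v
∑box-1 []      = refl
∑box-1 (a ∷ v) = trans (∑box-∷ a v _) (table a (∑box-1 v))
  where
  S : ℤ
  S = ∑box v (λ _ → 1ℤ)
  one : ∀ p q → 1ℤ * (p * q) + 0ℤ ≡ p * q
  one = solve-∀
  two : ∀ p q → 1ℤ * (p * q) + (1ℤ * (p * q) + 0ℤ) ≡ + 2 * p * q
  two = solve-∀
  three : ∀ p q → 1ℤ * (p * q) + (1ℤ * (p * q) + (1ℤ * (p * q) + 0ℤ)) ≡ p * (+ 3 * q)
  three = solve-∀
  table : ∀ a → S ≡ (+ 2) ^ t 1F v * (+ 3) ^ t 2F v →
    ∑ (allFin 3) (λ y → ⟦ y ≤? a ⟧ * S) ≡ (+ 2) ^ t 1F (a ∷ v) * (+ 3) ^ t 2F (a ∷ v)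
  table 0F eq rewrite eq = one   ((+ 2) ^ t 1F v) ((+ 3) ^ t 2F v)
  table 1F eq rewrite eq = two   ((+ 2) ^ t 1F v) ((+ 3) ^ t 2F v)
  table 2F eq rewrite eq = three ((+ 2) ^ t 1F v) ((+ 3) ^ t 2F v)

∈box-𝟐 : (x : Vec F₃ n) → x ∈box 𝟐
∈box-𝟐 []      = []
∈box-𝟐 (a ∷ x) = toℕ≤pred[n] a ∷ ∈box-𝟐 x

∑box-𝟐 : (f : Vec F₃ n → ℤ) → ∑box 𝟐 f ≡ ∑ (F₃^ n) f
∑box-𝟐 {n} f = ∑-cong (F₃^ n) λ x →
  trans (cong (λ b → (if b then 1ℤ else 0ℤ) * f x) (dec-true (x ∈box? 𝟐) (∈box-𝟐 x))) (*-identityˡ (f x))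

-- The sum of ω^(u · x) over x in box(v) is K v u ω^(- s₁ v u).
K : (v u : Vec F₃ n) → ℤ
K v u = (+ 3) ^ t 2F v * + toℕ (e v u) * (+ 2) ^ z v u * -1ℤ ^ o v u

K-∷ : ∀ a b (v u : Vec F₃ n) → K (a ∷ v) (b ∷ u) ≡ κ a b * K v u
K-∷ 0F b v u rewrite e-∷ 0F b v u = sym (*-identityˡ (K v u))
K-∷ 1F 0F v u rewrite e-∷ 1F 0F v u = double ((+ 3) ^ t 2F v * + toℕ (e v u)) ((+ 2) ^ z v u) (-1ℤ ^ o v u)
  where
  double : ∀ p q r → p * (+ 2 * q) * r ≡ + 2 * (p * q * r)
  double = solve-∀
K-∷ 1F (suc b) v u rewrite e-∷ 1F (suc b) v u | +-∸-assoc 1 (z≤t₁ v u) =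
  negate ((+ 3) ^ t 2F v * + toℕ (e v u)) ((+ 2) ^ z v u) (-1ℤ ^ o v u)
  where
  negate : ∀ p q r → p * q * (-1ℤ * r) ≡ -1ℤ * (p * q * r)
  negate = solve-∀
K-∷ 2F 0F v u rewrite e-∷ 2F 0F v u = triple ((+ 3) ^ t 2F v) (+ toℕ (e v u)) ((+ 2) ^ z v u) (-1ℤ ^ o v u)
  where
  triple : ∀ p x q r → + 3 * p * x * q * r ≡ + 3 * (p * x * q * r)
  triple = solve-∀
K-∷ 2F (suc b) v u rewrite e-∷ 2F (suc b) v u = vanish ((+ 3) ^ t 2F v) ((+ 2) ^ z v u) (-1ℤ ^ o v u)
  where
  vanish : ∀ p q r → + 3 * p * 0ℤ * q * r ≡ 0ℤ
  vanish = solve-∀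

-- The shift c makes the induction work: the first coordinate of x is absorbed
-- into it.
∑box-φ : ∀ (v u : Vec F₃ n) c →
  ∑box v (λ x → φ (c +₃ u · x)) ≡ K v u * φ (c +₃ (s₁ v u +₃ s₁ v u))
∑box-φ []      []      c = base (φ (c +₃ 0F))
  where
  base : ∀ a → 1ℤ * a + 0ℤ ≡ 1ℤ * a
  base = solve-∀
∑box-φ (a ∷ v) (b ∷ u) c = begin
  ∑box (a ∷ v) (λ x → φ (c +₃ (b ∷ u) · x))
    ≡⟨ ∑box-∷ a v _ ⟩
  ∑ (allFin 3) (λ y → ⟦ y ≤? a ⟧ * ∑box v (λ x → φ (c +₃ (b *₃ y +₃ u · x))))
    ≡⟨ ∑-cong (allFin 3) fibre ⟩
  ∑ (allFin 3) (λ y → K v u * (⟦ y ≤? a ⟧ * φ ((c +₃ b *₃ y) +₃ (s +₃ s))))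
    ≡⟨ ∑-*ˡ (K v u) (allFin 3) (λ y → ⟦ y ≤? a ⟧ * φ ((c +₃ b *₃ y) +₃ (s +₃ s))) ⟩
  K v u * ∑ (allFin 3) (λ y → ⟦ y ≤? a ⟧ * φ ((c +₃ b *₃ y) +₃ (s +₃ s)))
    ≡⟨ cong (K v u *_) (∑-φ a b c s) ⟩
  K v u * (κ a b * φ′)
    ≡⟨ swap (K v u) (κ a b) φ′ ⟩
  κ a b * K v u * φ′
    ≡⟨ cong (_* φ′) (K-∷ a b v u) ⟨
  K (a ∷ v) (b ∷ u) * φ′ ∎
  where
  s : F₃
  s = s₁ v u
  φ′ : ℤ
  φ′ = φ (c +₃ ((σ a b +₃ s) +₃ (σ a b +₃ s)))
  swap : ∀ p q r → p * (q * r) ≡ q * p * r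
  swap = solve-∀
  fibre : ∀ y → ⟦ y ≤? a ⟧ * ∑box v (λ x → φ (c +₃ (b *₃ y +₃ u · x)))
              ≡ K v u * (⟦ y ≤? a ⟧ * φ ((c +₃ b *₃ y) +₃ (s +₃ s)))
  fibre y = begin
    ⟦ y ≤? a ⟧ * ∑box v (λ x → φ (c +₃ (b *₃ y +₃ u · x)))
      ≡⟨ cong (⟦ y ≤? a ⟧ *_) (∑-cong (F₃^ _) λ x →
           cong (λ d → ⟦ x ∈box? v ⟧ * φ d) (+₃-assoc c (b *₃ y) (u · x))) ⟩
    ⟦ y ≤? a ⟧ * ∑box v (λ x → φ ((c +₃ b *₃ y) +₃ u · x))
      ≡⟨ cong (⟦ y ≤? a ⟧ *_) (∑box-φ v u (c +₃ b *₃ y)) ⟩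
    ⟦ y ≤? a ⟧ * (K v u * φ ((c +₃ b *₃ y) +₃ (s +₃ s)))
      ≡⟨ trans (swap ⟦ y ≤? a ⟧ (K v u) (φ ((c +₃ b *₃ y) +₃ (s +₃ s))))
               (*-assoc (K v u) ⟦ y ≤? a ⟧ (φ ((c +₃ b *₃ y) +₃ (s +₃ s)))) ⟩
    K v u * (⟦ y ≤? a ⟧ * φ ((c +₃ b *₃ y) +₃ (s +₃ s))) ∎

-- Size of the complement and weights of the codewords

wt-map : (g : A → F₃) (xs : List A) →
  + wt (Vec.map g (fromList xs)) ≡ ∑ xs (λ x → ⟦ ¬? (g x ≟F 0F) ⟧)
wt-map g []       = refl
wt-map g (x ∷ xs) with does (g x ≟F 0F)
... | true  = trans (wt-map g xs) (sym (+-identityˡ _))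
... | false = trans (pos-+ 1 _) (cong (λ r → 1ℤ + r) (wt-map g xs))

∑box-φ₀ : (v u : Vec F₃ n) → ∑box v (λ x → φ (u · x)) ≡ K v u * φ (s₁ v u)
∑box-φ₀ {n} v u = begin
  ∑box v (λ x → φ (u · x))
    ≡⟨ ∑-cong (F₃^ n) (λ x → cong (λ d → ⟦ x ∈box? v ⟧ * φ d) (+₃-identityˡ (u · x))) ⟨
  ∑box v (λ x → φ (0F +₃ u · x))
    ≡⟨ ∑box-φ v u 0F ⟩
  K v u * φ (0F +₃ (s₁ v u +₃ s₁ v u))
    ≡⟨ cong (K v u *_) (φ-double (s₁ v u)) ⟩
  K v u * φ (s₁ v u) ∎
  where
  -- φ is even, and s + s = - s.
  φ-double : ∀ s → φ (0F +₃ (s +₃ s)) ≡ φ s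
  φ-double = from-yes (all? λ s → φ (0F +₃ (s +₃ s)) ≟ℤ φ s)

∑-φ≡0 : (u : Vec F₃ n) → u ≢ 𝟎 → ∑ (F₃^ n) (λ x → φ (u · x)) ≡ 0ℤ
∑-φ≡0 {n} u u≢𝟎 = begin
  ∑ (F₃^ n) (λ x → φ (u · x))   ≡⟨ ∑box-𝟐 (λ x → φ (u · x)) ⟨
  ∑box 𝟐 (λ x → φ (u · x))      ≡⟨ ∑box-φ₀ 𝟐 u ⟩
  K 𝟐 u * φ (s₁ 𝟐 u)            ≡⟨ cong (λ ε → q * + toℕ ε * p * m * φ (s₁ 𝟐 u)) (e-𝟐 u u≢𝟎) ⟩
  q * 0ℤ * p * m * φ (s₁ 𝟐 u)   ≡⟨ vanish q p m (φ (s₁ 𝟐 u)) ⟩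
  0ℤ ∎
  where
  q p m : ℤ
  q = (+ 3) ^ t 2F (𝟐 {n})
  p = (+ 2) ^ z 𝟐 u
  m = -1ℤ ^ o 𝟐 u
  vanish : ∀ p q r s → p * 0ℤ * q * r * s ≡ 0ℤ
  vanish = solve-∀

length-boxComplement : (v : Vec F₃ n) →
  + length (boxComplement v) ≡ (+ 3) ^ n - (+ 2) ^ t 1F v * (+ 3) ^ t 2F v
length-boxComplement {n} v = begin
  + length (boxComplement v)                          ≡⟨ length≡∑ (boxComplement v) ⟩
  ∑ (boxComplement v) (λ _ → 1ℤ)                      ≡⟨ ∑-filter-¬ (_∈box? v) (F₃^ n) _ ⟩
  ∑ (F₃^ n) (λ _ → 1ℤ) - ∑box v (λ _ → 1ℤ)            ≡⟨ cong₂ _-_ (∑-1 n) (∑box-1 v) ⟩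
  (+ 3) ^ n - (+ 2) ^ t 1F v * (+ 3) ^ t 2F v         ∎

𝟐∈box⇒≡𝟐 : (v : Vec F₃ n) → 𝟐 ∈box v → v ≡ 𝟐
𝟐∈box⇒≡𝟐 []       []       = refl
𝟐∈box⇒≡𝟐 (0F ∷ v) (() ∷ _)
𝟐∈box⇒≡𝟐 (1F ∷ v) (s≤s () ∷ _)
𝟐∈box⇒≡𝟐 (2F ∷ v) (_ ∷ p)  = cong (2F ∷_) (𝟐∈box⇒≡𝟐 v p)

boxComplement-nonempty : (v : Vec F₃ n) → v ≢ 𝟐 → 0 < length (boxComplement v)
boxComplement-nonempty v v≢𝟐 =
  ∈-length (∈-filter⁺ (λ x → ¬? (x ∈box? v)) (F₃^-complete 𝟐) (v≢𝟐 ∘ 𝟐∈box⇒≡𝟐 v))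

-- The weight formula, multiplied by 3.
weight : (v u : Vec F₃ n) → u ≢ 𝟎 →
  + 3 * + wt (codeword (boxComplement v) u)
    ≡ + 2 * + length (boxComplement v) + K v u * φ (s₁ v u)
weight {n} v u u≢𝟎 = begin
  + 3 * + wt (codeword D u)
    ≡⟨ cong (+ 3 *_) (wt-map (u ·_) D) ⟩
  + 3 * ∑ D (λ x → ⟦ ¬? (u · x ≟F 0F) ⟧)
    ≡⟨ ∑-*ˡ (+ 3) D _ ⟨
  ∑ D (λ x → + 3 * ⟦ ¬? (u · x ≟F 0F) ⟧)
    ≡⟨ ∑-cong D (λ x → 3⟦≢0⟧ (u · x)) ⟩
  ∑ D (λ x → + 2 * 1ℤ - φ (u · x))
    ≡⟨ ∑-- D (λ _ → + 2 * 1ℤ) (λ x → φ (u · x)) ⟩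
  ∑ D (λ _ → + 2 * 1ℤ) - ∑ D (λ x → φ (u · x))
    ≡⟨ cong₂ _-_ (trans (∑-*ˡ (+ 2) D _) (cong (+ 2 *_) (sym (length≡∑ D))))
                 (∑-filter-¬ (_∈box? v) (F₃^ n) _) ⟩
  + 2 * + length D - (∑ (F₃^ n) (λ x → φ (u · x)) - ∑box v (λ x → φ (u · x)))
    ≡⟨ cong₂ (λ a b → + 2 * + length D - (a - b)) (∑-φ≡0 u u≢𝟎) (∑box-φ₀ v u) ⟩
  + 2 * + length D - (0ℤ - K v u * φ (s₁ v u))
    ≡⟨ cancel (+ 2 * + length D) (K v u * φ (s₁ v u)) ⟩
  + 2 * + length D + K v u * φ (s₁ v u) ∎
  where
  D : List (Vec F₃ n)
  D = boxComplement v
  cancel : ∀ a b → a - (0ℤ - b) ≡ a + b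
  cancel = solve-∀

-- Recurrences for the counting formula

t-sum : (v : Vec F₃ n) → t 1F v ℕ.+ (t 2F v ℕ.+ t 0F v) ≡ n
t-sum []       = refl
t-sum (0F ∷ v) = trans (cong (t 1F v ℕ.+_) (+-suc (t 2F v) (t 0F v)))
                       (trans (+-suc (t 1F v) (t 2F v ℕ.+ t 0F v)) (cong suc (t-sum v)))
t-sum (1F ∷ v) = cong suc (t-sum v)
t-sum (2F ∷ v) = trans (+-suc (t 1F v) (t 2F v ℕ.+ t 0F v)) (cong suc (t-sum v))

t₀≡n∸t₁∸t₂ : (v : Vec F₃ n) → n ∸ t 1F v ∸ t 2F v ≡ t 0F v
t₀≡n∸t₁∸t₂ {n} v = begin
  n ∸ t₁ ∸ t₂                        ≡⟨ cong (λ m → m ∸ t₁ ∸ t₂) (t-sum v) ⟨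
  t₁ ℕ.+ (t₂ ℕ.+ t 0F v) ∸ t₁ ∸ t₂   ≡⟨ cong (_∸ t₂) (m+n∸m≡n t₁ (t₂ ℕ.+ t 0F v)) ⟩
  t₂ ℕ.+ t 0F v ∸ t₂                 ≡⟨ m+n∸m≡n t₂ (t 0F v) ⟩
  t 0F v                             ∎
  where
  t₁ t₂ : ℕ
  t₁ = t 1F v
  t₂ = t 2F v

-- Moving b to the other side adds - b = b + b.
transpose : ∀ b s c → does (b +₃ s ≟F c) ≡ does (s ≟F c +₃ (b +₃ b))
transpose = from-yes (all? λ b → all? λ s → all? λ c →
  does (b +₃ s ≟F c) ≟𝔹 does (s ≟F c +₃ (b +₃ b)))

N-suc : ∀ c k → + N c (suc k) ≡ + N (c +₃ 2F) k + + N (c +₃ 1F) k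
N-suc c k = begin
  + N c (suc k)
    ≡⟨ length-filter (λ w → Σ₃ w ≟F c) (words ±1 (suc k)) ⟩
  ∑ (words ±1 (suc k)) (λ w → ⟦ Σ₃ w ≟F c ⟧)
    ≡⟨ ∑-words ±1 k _ ⟩
  ∑ (words ±1 k) (λ w → ⟦ 1F +₃ Σ₃ w ≟F c ⟧) + (∑ (words ±1 k) (λ w → ⟦ 2F +₃ Σ₃ w ≟F c ⟧) + 0ℤ)
    ≡⟨ cong₂ (λ a b → a + (b + 0ℤ))
         (trans (∑-cong (words ±1 k) λ w → indicator 1F (Σ₃ w)) (sym (length-filter (λ w → Σ₃ w ≟F c +₃ 2F) (words ±1 k))))
         (trans (∑-cong (words ±1 k) λ w → indicator 2F (Σ₃ w)) (sym (length-filter (λ w → Σ₃ w ≟F c +₃ 1F) (words ±1 k)))) ⟩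
  + N (c +₃ 2F) k + (+ N (c +₃ 1F) k + 0ℤ)
    ≡⟨ cong (λ r → + N (c +₃ 2F) k + r) (+-identityʳ (+ N (c +₃ 1F) k)) ⟩
  + N (c +₃ 2F) k + + N (c +₃ 1F) k ∎
  where
  ±1 : List F₃
  ±1 = 1F ∷ 2F ∷ []
  indicator : ∀ b s → ⟦ b +₃ s ≟F c ⟧ ≡ ⟦ s ≟F c +₃ (b +₃ b) ⟧
  indicator b s = cong (if_then 1ℤ else 0ℤ) (transpose b s c)

-- The number of words of length m over F₃ with exactly k zeros and coordinate
-- sum c.
CN : ℕ → ℕ → F₃ → ℤ
CN m k c = + (m C k) * + N c (m ∸ k)

-- For k > m both sides vanish with the binomial coefficient, so no bound on k
-- is needed although the subtractions are truncated.
C-N-suc : ∀ m k c → + (m C k) * + N c (suc m ∸ k) ≡ CN m k (c +₃ 2F) + CN m k (c +₃ 1F)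
C-N-suc m k c with k ≤ℕ? m
... | yes k≤m rewrite +-∸-assoc 1 k≤m =
  trans (cong (+ (m C k) *_) (N-suc c (m ∸ k))) (distrib (+ (m C k)) (+ N (c +₃ 2F) (m ∸ k)) (+ N (c +₃ 1F) (m ∸ k)))
  where
  distrib : ∀ a b d → a * (b + d) ≡ a * b + a * d
  distrib = solve-∀
... | no k≰m rewrite k>n⇒nCk≡0 (≰⇒> k≰m) = refl

-- Conditioning on the first letter: it is 0, 1 or 2.
CN-suc : ∀ m k c → CN (suc m) (suc k) c ≡ CN m k c + (CN m (suc k) (c +₃ 2F) + CN m (suc k) (c +₃ 1F))
CN-suc m k c = begin
  + (suc m C suc k) * ν                             ≡⟨ cong (λ b → + b * ν) (nCk+nC[k+1]≡[n+1]C[k+1] m k) ⟨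
  + (m C k ℕ.+ m C suc k) * ν                       ≡⟨ cong (_* ν) (pos-+ (m C k) (m C suc k)) ⟩
  (+ (m C k) + + (m C suc k)) * ν                   ≡⟨ distrib (+ (m C k)) (+ (m C suc k)) ν ⟩
  CN m k c + + (m C suc k) * ν                      ≡⟨ cong (λ r → CN m k c + r) (C-N-suc m (suc k) c) ⟩
  CN m k c + (CN m (suc k) (c +₃ 2F) + CN m (suc k) (c +₃ 1F)) ∎
  where
  ν : ℤ
  ν = + N c (m ∸ k)
  distrib : ∀ a b d → (a + b) * d ≡ a * d + b * d
  distrib = solve-∀

-- Counting vectors by their statistics

-- Whether a triple (ε′, ζ′, c′) is the prescribed (ε, ζ, c).
match? : (ε : Fin 2) (ζ : ℕ) (c : F₃) (ε′ : Fin 2) (ζ′ : ℕ) (c′ : F₃) → Dec (ε′ ≡ ε × ζ′ ≡ ζ × c′ ≡ c)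
match? ε ζ c ε′ ζ′ c′ = (ε′ ≟F ε) ×-dec (ζ′ ≟ℕ ζ) ×-dec (c′ ≟F c)

-- Whether (e, z, s₁) takes the value (ε, ζ, c) at u.
stats? : (v : Vec F₃ n) (ε : Fin 2) (ζ : ℕ) (c : F₃) (u : Vec F₃ n) → Dec (e v u ≡ ε × z v u ≡ ζ × s₁ v u ≡ c)
stats? v ε ζ c u = match? ε ζ c (e v u) (z v u) (s₁ v u)

-- The number of words of length m over F₃ that are zero (ε = 1) or nonzero
-- (ε = 0).
W : Fin 2 → ℕ → ℤ
W ε m = ⟦ ε ≟F 1F ⟧ + ((+ 3) ^ m - 1ℤ) * ⟦ ε ≟F 0F ⟧

match?-shift : ∀ ε ζ c c′ x y s s′ → does (s ≟F c) ≡ does (s′ ≟F c′) →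
  ⟦ match? ε ζ c x y s ⟧ ≡ ⟦ match? ε ζ c′ x y s′ ⟧
match?-shift ε ζ c c′ x y s s′ =
  cong (λ b → if does (x ≟F ε) ∧ (does (y ≟ℕ ζ) ∧ b) then 1ℤ else 0ℤ)

match?-+₃ : ∀ ε ζ c x y b s → ⟦ match? ε ζ c x y (b +₃ s) ⟧ ≡ ⟦ match? ε ζ (c +₃ (b +₃ b)) x y s ⟧
match?-+₃ ε ζ c x y b s = match?-shift ε ζ c (c +₃ (b +₃ b)) x y (b +₃ s) s (transpose b s c)

match?-suc-0 : ∀ ε c x y s → ⟦ match? ε 0 c x (suc y) s ⟧ ≡ 0ℤ
match?-suc-0 ε c x y s = cong (if_then 1ℤ else 0ℤ) (∧-zeroʳ (does (x ≟F ε)))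

-- A value of e forced to be 0 is compatible with either value of e on the rest
-- of the vector.
match?-0F : ∀ ζ c x y s → ⟦ match? 0F ζ c 0F y s ⟧ ≡ ⟦ match? 0F ζ c x y s ⟧ + ⟦ match? 1F ζ c x y s ⟧
match?-0F ζ c 0F y s = sym (+-identityʳ ⟦ match? 0F ζ c 0F y s ⟧)
match?-0F ζ c 1F y s = sym (+-identityˡ ⟦ match? 1F ζ c 1F y s ⟧)

-- The count with u = 0 included, for every ζ: for ζ > t₁ both sides are 0.
∑-stats : (v : Vec F₃ n) (ε : Fin 2) (ζ : ℕ) (c : F₃) →
  ∑ (F₃^ n) (λ u → ⟦ stats? v ε ζ c u ⟧) ≡ W ε (t 2F v) * CN (t 1F v) ζ c * (+ 3) ^ t 0F v
∑-stats [] 0F zero    0F = refl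
∑-stats [] 0F zero    1F = refl
∑-stats [] 0F zero    2F = refl
∑-stats [] 1F zero    0F = refl
∑-stats [] 1F zero    1F = refl
∑-stats [] 1F zero    2F = refl
∑-stats [] 0F (suc ζ) c  = refl
∑-stats [] 1F (suc ζ) c  = refl
∑-stats {suc n} (a ∷ v) ε ζ c = trans (∑-words (allFin 3) n _) (split a ε ζ)
  where
  P : ℤ
  P = (+ 3) ^ t 0F v

  -- The contribution of the vectors u that start with b, when v starts with a.
  F : F₃ → Fin 2 → ℕ → F₃ → ℤ
  F a ε ζ b = ∑ (F₃^ n) (λ u → ⟦ stats? (a ∷ v) ε ζ c (b ∷ u) ⟧)

  -- The value given by the induction hypothesis.
  R : Fin 2 → ℕ → F₃ → ℤ
  R ε ζ c = W ε (t 2F v) * CN (t 1F v) ζ c * P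

  F-cong : ∀ a ε ζ b (g : Vec F₃ n → ℤ) →
    (∀ u → ⟦ match? ε ζ c (if does (a ≟F 2F) ∧ not (does (b ≟F 0F)) then 0F else e v u)
                    (z (a ∷ v) (b ∷ u)) (σ a b +₃ s₁ v u) ⟧ ≡ g u) →
    F a ε ζ b ≡ ∑ (F₃^ n) g
  F-cong a ε ζ b g eq = ∑-cong (F₃^ n) λ u →
    trans (cong (λ x → ⟦ match? ε ζ c x (z (a ∷ v) (b ∷ u)) (σ a b +₃ s₁ v u) ⟧) (e-∷ a b v u)) (eq u)

  keep : ∀ ε ζ u → ⟦ match? ε ζ c (e v u) (z v u) (0F +₃ s₁ v u) ⟧ ≡ ⟦ stats? v ε ζ c u ⟧
  keep ε ζ u = cong (λ s → ⟦ match? ε ζ c (e v u) (z v u) s ⟧) (+₃-identityˡ (s₁ v u))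

  F₀ : ∀ ε ζ b → F 0F ε ζ b ≡ R ε ζ c
  F₀ ε ζ b = trans (F-cong 0F ε ζ b _ (keep ε ζ)) (∑-stats v ε ζ c)

  F₁-0-zero : ∀ ε → F 1F ε zero 0F ≡ 0ℤ
  F₁-0-zero ε = trans
    (F-cong 1F ε zero 0F (λ _ → 0ℤ) λ u → match?-suc-0 ε c (e v u) (z v u) (0F +₃ s₁ v u))
    (∑-zero (F₃^ n))

  F₁-0-suc : ∀ ε ζ → F 1F ε (suc ζ) 0F ≡ R ε ζ c
  F₁-0-suc ε ζ = trans (F-cong 1F ε (suc ζ) 0F _ (keep ε ζ)) (∑-stats v ε ζ c)

  F₁-suc : ∀ ε ζ b → F 1F ε ζ (suc b) ≡ R ε ζ (c +₃ (suc b +₃ suc b))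
  F₁-suc ε ζ b = trans
    (F-cong 1F ε ζ (suc b) (λ u → ⟦ stats? v ε ζ (c +₃ (suc b +₃ suc b)) u ⟧)
      λ u → match?-+₃ ε ζ c (e v u) (z v u) (suc b) (s₁ v u))
    (∑-stats v ε ζ (c +₃ (suc b +₃ suc b)))

  F₂-0 : ∀ ε ζ → F 2F ε ζ 0F ≡ R ε ζ c
  F₂-0 ε ζ = trans (F-cong 2F ε ζ 0F _ (keep ε ζ)) (∑-stats v ε ζ c)

  F₂-suc-0F : ∀ ζ b → F 2F 0F ζ (suc b) ≡ R 0F ζ c + R 1F ζ c
  F₂-suc-0F ζ b = begin
    F 2F 0F ζ (suc b)
      ≡⟨ F-cong 2F 0F ζ (suc b) (λ u → ⟦ stats? v 0F ζ c u ⟧ + ⟦ stats? v 1F ζ c u ⟧) (λ u → trans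
           (cong (λ s → ⟦ match? 0F ζ c 0F (z v u) s ⟧) (+₃-identityˡ (s₁ v u)))
           (match?-0F ζ c (e v u) (z v u) (s₁ v u))) ⟩
    ∑ (F₃^ n) (λ u → ⟦ stats? v 0F ζ c u ⟧ + ⟦ stats? v 1F ζ c u ⟧)
      ≡⟨ ∑-+ (F₃^ n) _ _ ⟩
    ∑ (F₃^ n) (λ u → ⟦ stats? v 0F ζ c u ⟧) + ∑ (F₃^ n) (λ u → ⟦ stats? v 1F ζ c u ⟧)
      ≡⟨ cong₂ _+_ (∑-stats v 0F ζ c) (∑-stats v 1F ζ c) ⟩
    R 0F ζ c + R 1F ζ c ∎

  F₂-suc-1F : ∀ ζ b → F 2F 1F ζ (suc b) ≡ 0ℤ
  F₂-suc-1F ζ b = trans (F-cong 2F 1F ζ (suc b) (λ _ → 0ℤ) (λ u → refl)) (∑-zero (F₃^ n))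

  add : ∀ {x₀ x₁ x₂ y₀ y₁ y₂ : ℤ} → x₀ ≡ y₀ → x₁ ≡ y₁ → x₂ ≡ y₂ →
    x₀ + (x₁ + (x₂ + 0ℤ)) ≡ y₀ + (y₁ + (y₂ + 0ℤ))
  add refl refl refl = refl

  split : ∀ a ε ζ → ∑ (allFin 3) (F a ε ζ) ≡ W ε (t 2F (a ∷ v)) * CN (t 1F (a ∷ v)) ζ c * (+ 3) ^ t 0F (a ∷ v)
  split 0F ε ζ = trans
    (add (F₀ ε ζ 0F) (F₀ ε ζ 1F) (F₀ ε ζ 2F))
    (collect (W ε (t 2F v) * CN (t 1F v) ζ c) P)
    where
    collect : ∀ a p → a * p + (a * p + (a * p + 0ℤ)) ≡ a * (+ 3 * p)
    collect = solve-∀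
  split 1F ε zero = trans
    (add (F₁-0-zero ε) (F₁-suc ε 0 0F) (F₁-suc ε 0 1F))
    (trans (collect (W ε (t 2F v)) (CN (t 1F v) 0 (c +₃ 2F)) (CN (t 1F v) 0 (c +₃ 1F)) P)
           (cong (λ r → W ε (t 2F v) * r * P) (sym (C-N-suc (t 1F v) 0 c))))
    where
    collect : ∀ w a b p → 0ℤ + (w * a * p + (w * b * p + 0ℤ)) ≡ w * (a + b) * p
    collect = solve-∀
  split 1F ε (suc ζ) = trans
    (add (F₁-0-suc ε ζ) (F₁-suc ε (suc ζ) 0F) (F₁-suc ε (suc ζ) 1F))
    (trans (collect (W ε (t 2F v)) (CN (t 1F v) ζ c) (CN (t 1F v) (suc ζ) (c +₃ 2F)) (CN (t 1F v) (suc ζ) (c +₃ 1F)) P)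
           (cong (λ r → W ε (t 2F v) * r * P) (sym (CN-suc (t 1F v) ζ c))))
    where
    collect : ∀ w a b d p → w * a * p + (w * b * p + (w * d * p + 0ℤ)) ≡ w * (a + (b + d)) * p
    collect = solve-∀
  split 2F 0F ζ = trans
    (add (F₂-0 0F ζ) (F₂-suc-0F ζ 0F) (F₂-suc-0F ζ 1F))
    (collect ((+ 3) ^ t 2F v) (CN (t 1F v) ζ c) P)
    where
    collect : ∀ q a p →
      (0ℤ + (q - 1ℤ) * 1ℤ) * a * p
        + (((0ℤ + (q - 1ℤ) * 1ℤ) * a * p + (1ℤ + (q - 1ℤ) * 0ℤ) * a * p)
        + (((0ℤ + (q - 1ℤ) * 1ℤ) * a * p + (1ℤ + (q - 1ℤ) * 0ℤ) * a * p) + 0ℤ))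
        ≡ (0ℤ + (+ 3 * q - 1ℤ) * 1ℤ) * a * p
    collect = solve-∀
  split 2F 1F ζ = trans
    (add (F₂-0 1F ζ) (F₂-suc-1F ζ 0F) (F₂-suc-1F ζ 1F))
    (collect ((+ 3) ^ t 2F v) (CN (t 1F v) ζ c) P)
    where
    collect : ∀ q a p →
      (1ℤ + (q - 1ℤ) * 0ℤ) * a * p + (0ℤ + (0ℤ + 0ℤ)) ≡ (1ℤ + (+ 3 * q - 1ℤ) * 0ℤ) * a * p
    collect = solve-∀

stats?-𝟎 : (v : Vec F₃ n) (ε : Fin 2) (ζ : ℕ) (c : F₃) →
  ⟦ stats? v ε ζ c 𝟎 ⟧ ≡ ⟦ (ε ≟F 1F) ×-dec (ζ ≟ℕ t 1F v) ×-dec (c ≟F 0F) ⟧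
stats?-𝟎 v ε ζ c = ⟦⟧-cong
  (mk⇔ (λ (p , q , r) → trans (sym p) (e-𝟎 v) , trans (sym q) (z-𝟎 v) , trans (sym r) (s₁-𝟎 v))
       (λ (p , q , r) → trans (e-𝟎 v) (sym p) , trans (z-𝟎 v) (sym q) , trans (s₁-𝟎 v) (sym r)))
  (stats? v ε ζ c 𝟎) ((ε ≟F 1F) ×-dec (ζ ≟ℕ t 1F v) ×-dec (c ≟F 0F))

-- The count of nonzero vectors: the zero vector is removed from ∑-stats.
count-stats : (v : Vec F₃ n) (ε : Fin 2) (ζ : ℕ) (c : F₃) →
  + #[ (λ u → ¬? (u ≟ᵛ 𝟎) ×-dec stats? v ε ζ c u) ]
    ≡ W ε (t 2F v) * + (t 1F v C ζ) * + N c (t 1F v ∸ ζ) * (+ 3) ^ (n ∸ t 1F v ∸ t 2F v)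
        - ⟦ (ε ≟F 1F) ×-dec (ζ ≟ℕ t 1F v) ×-dec (c ≟F 0F) ⟧
count-stats {n} v ε ζ c = begin
  + #[ (λ u → ¬? (u ≟ᵛ 𝟎) ×-dec stats? v ε ζ c u) ]
    ≡⟨ length-filter (λ u → ¬? (u ≟ᵛ 𝟎) ×-dec stats? v ε ζ c u) (F₃^ n) ⟩
  ∑ (F₃^ n) (λ u → ⟦ ¬? (u ≟ᵛ 𝟎) ×-dec stats? v ε ζ c u ⟧)
    ≡⟨ ∑-cong (F₃^ n) (λ u → ⟦¬×⟧ (u ≟ᵛ 𝟎) (stats? v ε ζ c u)) ⟩
  ∑ (F₃^ n) (λ u → ⟦ stats? v ε ζ c u ⟧ - ⟦ u ≟ᵛ 𝟎 ⟧ * ⟦ stats? v ε ζ c u ⟧)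
    ≡⟨ ∑-- (F₃^ n) _ _ ⟩
  ∑ (F₃^ n) (λ u → ⟦ stats? v ε ζ c u ⟧) - ∑ (F₃^ n) (λ u → ⟦ u ≟ᵛ 𝟎 ⟧ * ⟦ stats? v ε ζ c u ⟧)
    ≡⟨ cong₂ _-_ (∑-stats v ε ζ c) (trans (∑-𝟎 n _) (stats?-𝟎 v ε ζ c)) ⟩
  W ε (t 2F v) * CN (t 1F v) ζ c * (+ 3) ^ t 0F v - exception
    ≡⟨ cong₂ (λ a b → a * (+ 3) ^ b - exception)
         (sym (*-assoc (W ε (t 2F v)) (+ (t 1F v C ζ)) (+ N c (t 1F v ∸ ζ)))) (sym (t₀≡n∸t₁∸t₂ v)) ⟩
  W ε (t 2F v) * + (t 1F v C ζ) * + N c (t 1F v ∸ ζ) * (+ 3) ^ (n ∸ t 1F v ∸ t 2F v) - exception ∎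
  where
  exception : ℤ
  exception = ⟦ (ε ≟F 1F) ×-dec (ζ ≟ℕ t 1F v) ×-dec (c ≟F 0F) ⟧

/1≡/3 : ∀ w m → + 3 * w ≡ m → w / 1 ≡ m / 3
/1≡/3 w m 3w≡m = fromℚᵘ-cong {mkℚᵘ w 0} {mkℚᵘ m 2} (*≡* (begin
  w * + 3   ≡⟨ *-comm w (+ 3) ⟩
  + 3 * w   ≡⟨ 3w≡m ⟩
  m         ≡⟨ *-identityʳ m ⟨
  m * 1ℤ    ∎))

theorem6p2 : (n : ℕ) (v : Vec F₃ n) → v ≢ 𝟎 → v ≢ 𝟐 →
    let D  = boxComplement v
        t₁ = t 1F v
        t₂ = t 2F v
    in
      (+ length D ≡ (+ 3) ^ n - (+ 2) ^ t₁ * (+ 3) ^ t₂ × 0 < length D)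
      ×
      ((u : Vec F₃ n) → u ≢ 𝟎 →
        (+ wt (codeword D u)) / 1
          ≡ (+ 2 * + length D
              + (+ 3) ^ t₂ * + toℕ (e v u) * (+ 2) ^ z v u * -1ℤ ^ o v u * φ (s₁ v u)) / 3)
      ×
      ((ε : Fin 2) (ζ : ℕ) (c : F₃) → ζ ≤ t₁ →
        + #[ (λ u → ¬? (u ≟ᵛ 𝟎) ×-dec (e v u ≟F ε) ×-dec (z v u ≟ℕ ζ) ×-dec (s₁ v u ≟F c)) ]
          ≡ (⟦ ε ≟F 1F ⟧ + ((+ 3) ^ t₂ - 1ℤ) * ⟦ ε ≟F 0F ⟧)
              * + (t₁ C ζ) * + N c (t₁ ∸ ζ) * (+ 3) ^ (n ∸ t₁ ∸ t₂)
            - ⟦ (ε ≟F 1F) ×-dec (ζ ≟ℕ t₁) ×-dec (c ≟F 0F) ⟧)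
theorem6p2 n v _ v≢𝟐 =
    (length-boxComplement v , boxComplement-nonempty v v≢𝟐)
  , (λ u u≢𝟎 → /1≡/3 (+ wt (codeword (boxComplement v) u)) _ (weight v u u≢𝟎))
  , (λ ε ζ c _ → count-stats v ε ζ c)
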